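{- Let $d \geq 2$ and let $m_1 \leq m_2 \leq \dots \leq m_d$ be natural numbers. (1) If $d=2$, then $cub(TCC(m_1,m_2)) \geq box(TCC(m_1,m_2)) \geq m_1$. (2) If $d\geq 3$, then $cub(TCC(m_1,\dots,m_d)) \geq box(TCC(m_1,\dots,m_d))$, and $$box(TCC(m_1,\dots,m_d)) \geq (m_1+m_3+\dots+m_{d-2})+m_{d-1} \quad\text{when } d \text{ is odd},$$ $$box(TCC(m_1,\dots,m_d)) \geq (m_2+m_4+\dots+m_{d-2})+m_{d-1} \quad\text{when } d \text{ is even}.$$ Here the sum in parentheses runs over all odd indices from $1$ to $d-2$ when $d$ is odd, and over all even indices from $2$ to $d-2$ when $d$ is even.
   Context: Natural numbers here are positive integers. All graphs are finite, simple and undirected. Boxicity and cubicity: a $k$-box (resp. $k$-cube) is a Cartesian product of $k$ closed intervals (resp. closed unit-length intervals) of $\mathbb{R}$. A $k$-box (resp. $k$-cube) representation of a graph $\Gamma$ is a function $f$ assigning to each vertex a $k$-box (resp. $k$-cube) such that two distinct vertices $u,v$ are adjacent if and only if $f(u)\cap f(v)\neq\emptyset$. The boxicity $box(\Gamma)$ (resp. cubicity $cub(\Gamma)$) is the smallest non-negative integer $k$ for which $\Gamma$ has a $k$-box (resp. $k$-cube) representation; complete graphs have boxicity and cubicity $0$. For positive integers $a_1,\dots,a_s$, $TCC(a_1,\dots,a_s)$ (the transitive closure of the Cartesian product of the complete graphs $K_{a_1+1},\dots,K_{a_s+1}$) is the graph whose vertices are the integer $s$-tuples $x=(x_1,\dots,x_s)$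 with $0\leq x_i\leq a_i$ for all $i$, where two distinct vertices $x,y$ are adjacent if and only if either $x_i\leq y_i$ for all $i$, or $x_i\geq y_i$ for all $i$. -}

module Defs where

open import Data.Fin as Fin using (Fin; zero; suc; toℕ; fromℕ; fromℕ<; inject₁)
import Data.Fin.Properties as Fin
open import Data.List as List using (filter; allFin)
open import Data.Nat as ℕ using (ℕ; zero; suc; s≤s)
open import Data.Nat.Divisibility using (_∣?_)
import Data.Nat.Induction as ℕ
open import Data.Nat.ListAction using (sum)
import Data.Nat.Properties as ℕ
open import Data.Product using (_×_; _,_; ∃; proj₁; proj₂)
open import Data.Product.Function.NonDependent.Propositional using (_×-↔_)
open import Data.Rational as ℚ using (ℚ; 0ℚ; 1ℚ; _<_; _-_)
import Data.Rational.Properties as ℚ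
open import Data.Sum using (_⊎_; inj₁; inj₂; swap)
open import Data.Vec as Vec using (Vec; []; _∷_; lookup)
import Data.Vec.Properties as Vec
open import Data.Vec.Functional using (Vector)
open import Function using (_⇔_; mk⇔; _↔_; mk↔ₛ′; Inverse; Equivalence; _∘_)
open import Function.Properties.Inverse using (↔-trans; ↔-sym)
open import Level using (0ℓ) renaming (suc to lsuc)
open import Relation.Binary using (Rel; Symmetric; Irreflexive; Decidable; DecidableEquality; tri<; tri≈; tri>)
open import Relation.Binary.PropositionalEquality
open import Relation.Nullary using (¬_; Dec; yes; no; contradiction; ¬?)
open import Relation.Nullary.Decidable using (map′; _×-dec_; _⊎-dec_)
open import Relation.Unary as Unary using (Pred; _∈_; _≬_)

-- Two-sided Dedekind cuts in ℚ.
record ℝ : Set₁ where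
  field
    L U         : Pred ℚ 0ℓ
    L-inhabited : ∃ L
    U-inhabited : ∃ U
    L-rounded   : ∀ q → L q ⇔ (∃ λ r → q < r × L r)
    U-rounded   : ∀ r → U r ⇔ (∃ λ q → q < r × U q)
    disjoint    : ∀ q → ¬ (L q × U q)
    located     : ∀ {q r} → q < r → L q ⊎ U r

open ℝ

infix 4 _≤ᵣ_ _≃ᵣ_

_≤ᵣ_ : Rel ℝ 0ℓ
x ≤ᵣ y = ∀ {q} → L x q → L y q

-- Equality of reals; distinct records may present the same cut.
_≃ᵣ_ : Rel ℝ 0ℓ
x ≃ᵣ y = x ≤ᵣ y × y ≤ᵣ x

private
  -‿+-cancel : ∀ p t → (p ℚ.+ t) - t ≡ p
  -‿+-cancel p t = trans (ℚ.+-assoc p t (ℚ.- t))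
    (trans (cong (p ℚ.+_) (ℚ.+-inverseʳ t)) (ℚ.+-identityʳ p))

  +‿-cancel : ∀ p t → (p - t) ℚ.+ t ≡ p
  +‿-cancel p t = trans (ℚ.+-assoc p (ℚ.- t) t)
    (trans (cong (p ℚ.+_) (ℚ.+-inverseˡ t)) (ℚ.+-identityʳ p))

  -‿mono-< : ∀ {p q} t → p < q → p - t < q - t
  -‿mono-< t = ℚ.+-monoˡ-< (ℚ.- t)

infixl 6 _+ℚ_

-- A rational q lies below (above) x + t iff q - t lies below (above) x.
_+ℚ_ : ℝ → ℚ → ℝ
x +ℚ t = record
  { L           = λ q → L x (q - t)
  ; U           = λ q → U x (q - t)
  ; L-inhabited = let p , Lp = L-inhabited x in
                  p ℚ.+ t , subst (L x) (sym (-‿+-cancel p t)) Lp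
  ; U-inhabited = let p , Up = U-inhabited x in
                  p ℚ.+ t , subst (U x) (sym (-‿+-cancel p t)) Up
  ; L-rounded   = λ q → mk⇔
      (λ Lq → let r , q-t<r , Lr = Equivalence.to (L-rounded x (q - t)) Lq in
        r ℚ.+ t
        , subst (_< r ℚ.+ t) (+‿-cancel q t) (ℚ.+-monoˡ-< t q-t<r)
        , subst (L x) (sym (-‿+-cancel r t)) Lr)
      (λ (r , q<r , Lr) →
        Equivalence.from (L-rounded x (q - t)) (r - t , -‿mono-< t q<r , Lr))
  ; U-rounded   = λ r → mk⇔
      (λ Ur → let q , q<r-t , Uq = Equivalence.to (U-rounded x (r - t)) Ur in
        q ℚ.+ t
        , subst (q ℚ.+ t <_) (+‿-cancel r t) (ℚ.+-monoˡ-< t q<r-t)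
        , subst (U x) (sym (-‿+-cancel q t)) Uq)
      (λ (q , q<r , Uq) →
        Equivalence.from (U-rounded x (r - t)) (q - t , -‿mono-< t q<r , Uq))
  ; disjoint    = λ q → disjoint x (q - t)
  ; located     = λ q<r → located x (-‿mono-< t q<r)
  }

record Interval : Set₁ where
  field
    lo hi : ℝ
    lo≤hi : lo ≤ᵣ hi

open Interval

UnitLength : Pred Interval 0ℓ
UnitLength I = hi I ≃ᵣ lo I +ℚ 1ℚ

Box : ℕ → Set₁
Box k = Vector Interval k

IsCube : ∀ {k} → Pred (Box k) 0ℓ
IsCube B = ∀ i → UnitLength (B i)

⟦_⟧ : ∀ {k} → Box k → Pred (Vector ℝ k) 0ℓ
⟦ B ⟧ p = ∀ i → lo (B i) ≤ᵣ p i × p i ≤ᵣ hi (B i)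

record Graph : Set₁ where
  field
    V        : Set
    finite   : ∃ λ n → V ↔ Fin n
    _~_      : Rel V 0ℓ
    ~-sym    : Symmetric _~_
    ~-irrefl : Irreflexive _≡_ _~_
    _~?_     : Decidable _~_

IsBoxRepresentation : ∀ Γ {k} → Pred (Graph.V Γ → Box k) (lsuc 0ℓ)
IsBoxRepresentation Γ f = ∀ u v → u ≢ v → (u ~ v) ⇔ (⟦ f u ⟧ ≬ ⟦ f v ⟧)
  where open Graph Γ

HasBoxRepresentation : Graph → Pred ℕ (lsuc 0ℓ)
HasBoxRepresentation Γ k =
  ∃ λ (f : Graph.V Γ → Box k) → IsBoxRepresentation Γ f

HasCubeRepresentation : Graph → Pred ℕ (lsuc 0ℓ)
HasCubeRepresentation Γ k =
  ∃ λ (f : Graph.V Γ → Box k) → (∀ v → IsCube (f v)) × IsBoxRepresentation Γ f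

IsLeast : Pred ℕ (lsuc 0ℓ) → Pred ℕ (lsuc 0ℓ)
IsLeast P k = P k × (∀ j → P j → k ℕ.≤ j)

-- box(Γ) and cub(Γ) as functional relations: "k is the boxicity of Γ".
-- There is at most one such k by antisymmetry, and one cannot fail to exist;
-- see boxicity-exists and cubicity-exists below.
IsBoxicity IsCubicity : Graph → Pred ℕ (lsuc 0ℓ)
IsBoxicity Γ = IsLeast (HasBoxRepresentation Γ)
IsCubicity Γ = IsLeast (HasCubeRepresentation Γ)

record Tuple {s} (a : Vector ℕ s) : Set where
  constructor tuple
  field
    coords   : Vec ℕ s
    .bounded : ∀ i → lookup coords i ℕ.≤ a i

open Tuple

infixl 9 _!_

_!_ : ∀ {s} {a : Vector ℕ s} → Tuple a → Fin s → ℕ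
x ! i = lookup (coords x) i

private
  Tuple-finite : ∀ {s} (a : Vector ℕ s) → ∃ λ n → Tuple a ↔ Fin n
  Tuple-finite {zero}  a = 1 , mk↔ₛ′ (λ _ → zero) (λ _ → tuple [] λ ())
    (λ { zero → refl }) (λ { (tuple [] _) → refl })
  Tuple-finite {suc s} a = let n , e = Tuple-finite (a ∘ suc) in
    suc (a zero) ℕ.* n ,
    ↔-trans (mk↔ₛ′ uncons cons uncons-cons cons-uncons)
      (↔-trans (mk↔ₛ′ (λ x → x) (λ x → x) (λ _ → refl) (λ _ → refl) ×-↔ e)
        (↔-sym Fin.*↔×))
    where
    uncons : Tuple a → Fin (suc (a zero)) × Tuple (a ∘ suc)
    uncons (tuple (c ∷ cs) b) = fromℕ< (s≤s (b zero)) , tuple cs (b ∘ suc)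

    cons : Fin (suc (a zero)) × Tuple (a ∘ suc) → Tuple a
    cons (c , tuple cs b) = tuple (toℕ c ∷ cs)
      λ { zero → ℕ.s≤s⁻¹ (Fin.toℕ<n c) ; (suc i) → b i }

    uncons-cons : ∀ p → uncons (cons p) ≡ p
    uncons-cons (c , tuple cs b) = cong (_, tuple cs b) (Fin.fromℕ<-toℕ c _)

    tuple-cong : ∀ {c d} {cs : Vec ℕ s} → c ≡ d →
      .{b : ∀ i → lookup (c ∷ cs) i ℕ.≤ a i} .{b′ : ∀ i → lookup (d ∷ cs) i ℕ.≤ a i} →
      _≡_ {A = Tuple a} (tuple (c ∷ cs) b) (tuple (d ∷ cs) b′)
    tuple-cong refl = refl

    cons-uncons : ∀ x → cons (uncons x) ≡ x
    cons-uncons (tuple (c ∷ cs) b) = tuple-cong (Fin.toℕ-fromℕ< (s≤s (b zero)))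

  Tuple-≟ : ∀ {s} {a : Vector ℕ s} → DecidableEquality (Tuple a)
  Tuple-≟ (tuple x _) (tuple y _) =
    map′ (λ { refl → refl }) (cong coords) (Vec.≡-dec ℕ._≟_ x y)

TCC : ∀ {s} → Vector ℕ s → Graph
TCC a = record
  { V        = Tuple a
  ; finite   = Tuple-finite a
  ; _~_      = λ x y → x ≢ y × ((∀ i → x ! i ℕ.≤ y ! i) ⊎ (∀ i → x ! i ℕ.≥ y ! i))
  ; ~-sym    = λ (x≢y , c) → x≢y ∘ sym , swap c
  ; ~-irrefl = λ x≡y (x≢y , _) → x≢y x≡y
  ; _~?_     = λ x y → ¬? (Tuple-≟ x y) ×-dec
      (Fin.all? (λ i → x ! i ℕ.≤? y ! i) ⊎-dec Fin.all? (λ i → y ! i ℕ.≤? x ! i))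
  }

-- The position of i in the 1-based numbering m₁,…,m_d.
index : ∀ {d} → Fin d → ℕ
index i = suc (toℕ i)

sumOver : ∀ {d} {P : Pred (Fin d) 0ℓ} → Unary.Decidable P → Vector ℕ d → ℕ
sumOver {d} P? m = sum (List.map m (filter P? (allFin d)))

-- m₁ + m₃ + ⋯, over the odd indices at most d - 2
oddSum : ∀ {d} → Vector ℕ d → ℕ
oddSum {d} = sumOver λ i → ¬? (2 ∣? index i) ×-dec (index i ℕ.≤? d ℕ.∸ 2)

-- m₂ + m₄ + ⋯, over the even indices at most d - 2
evenSum : ∀ {d} → Vector ℕ d → ℕ
evenSum {d} = sumOver λ i → (2 ∣? index i) ×-dec (index i ℕ.≤? d ℕ.∸ 2)

-- m_{d-1}
penultimate : ∀ {n} → Vector ℕ (2 ℕ.+ n) → ℕ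
penultimate {n} m = m (inject₁ (fromℕ n))

-- Every graph has a boxicity and a cubicity.  Minimisation over an
-- undecided predicate gives existence only up to double negation.

private
  fromℚ : ℚ → ℝ
  fromℚ p = record
    { L           = _< p
    ; U           = p <_
    ; L-inhabited = p - 1ℚ , subst (p - 1ℚ <_) (ℚ.+-identityʳ p)
                      (ℚ.+-monoʳ-< p (ℚ.negative⁻¹ (ℚ.- 1ℚ)))
    ; U-inhabited = p ℚ.+ 1ℚ , subst (_< p ℚ.+ 1ℚ) (ℚ.+-identityʳ p)
                      (ℚ.+-monoʳ-< p (ℚ.positive⁻¹ 1ℚ))
    ; L-rounded   = λ q → mk⇔ ℚ.<-dense (λ (_ , q<r , r<p) → ℚ.<-trans q<r r<p)
    ; U-rounded   = λ r → mk⇔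
        (λ p<r → let q , p<q , q<r = ℚ.<-dense p<r in q , q<r , p<q)
        (λ (_ , q<r , p<q) → ℚ.<-trans p<q q<r)
    ; disjoint    = λ q (q<p , p<q) → ℚ.<-asym q<p p<q
    ; located     = located′
    }
    where
    located′ : ∀ {q r} → q < r → q < p ⊎ p < r
    located′ {q} q<r with ℚ.<-cmp q p
    ... | tri< q<p _ _  = inj₁ q<p
    ... | tri≈ _ refl _ = inj₂ q<r
    ... | tri> _ _ p<q  = inj₂ (ℚ.<-trans p<q q<r)

  unitInterval : ℚ → Interval
  unitInterval p = record
    { lo    = fromℚ p
    ; hi    = fromℚ p +ℚ 1ℚ
    ; lo≤hi = λ {q} q<p → ℚ.<-trans
        (subst (q - 1ℚ <_) (ℚ.+-identityʳ q) (ℚ.+-monoʳ-< q (ℚ.negative⁻¹ (ℚ.- 1ℚ)))) q<p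
    }

  least-exists : ∀ P {n} → P n → ¬ ¬ (∃ (IsLeast P))
  least-exists P {n} Pn none = ℕ.<-rec (¬_ ∘ P)
    (λ k smaller Pk → none (k , Pk , λ j Pj → ℕ.≮⇒≥ λ j<k → smaller j<k Pj)) n Pn

module _ (Γ : Graph) where
  open Graph Γ

  private
    N : ℕ
    N = proj₁ finite

    e : V ↔ Fin N
    e = proj₂ finite

    open Inverse e using (to; from; strictlyInverseʳ)

    -- In the coordinate belonging to w, vertex w gets [0,1], its neighbours
    -- get [1,2] and all other vertices get [2,3].
    2ℚ 1½ : ℚ
    2ℚ = 1ℚ ℚ.+ 1ℚ
    1½ = 1ℚ ℚ.+ ℚ.½

    start′ : ∀ {v w} → Dec (to v ≡ to w) → Dec (v ~ w) → ℚ
    start′ (yes _) _       = 0ℚ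
    start′ (no _)  (yes _) = 1ℚ
    start′ (no _)  (no _)  = 2ℚ

    start : V → V → ℚ
    start v w = start′ (to v Fin.≟ to w) (v ~? w)

    rep : V → Box N
    rep v i = unitInterval (start v (from i))

    to-injective : ∀ {u v} → to u ≡ to v → u ≡ v
    to-injective {u} {v} eq =
      trans (sym (strictlyInverseʳ u)) (trans (cong from eq) (strictlyInverseʳ v))

    Meet : ℚ → ℚ → Set₁
    Meet p q = ∃ λ x → (fromℚ p ≤ᵣ x × x ≤ᵣ fromℚ p +ℚ 1ℚ)
                     × (fromℚ q ≤ᵣ x × x ≤ᵣ fromℚ q +ℚ 1ℚ)

    meet-refl : ∀ p → Meet p p
    meet-refl p = fromℚ p , ((λ l → l) , lo≤hi (unitInterval p))
                          , ((λ l → l) , lo≤hi (unitInterval p))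

    meet-suc : ∀ p → Meet p (p ℚ.+ 1ℚ)
    meet-suc p = fromℚ (p ℚ.+ 1ℚ)
      , ((λ {q} q<p → subst (_< p ℚ.+ 1ℚ) (ℚ.+-identityʳ q)
            (ℚ.+-mono-< q<p (ℚ.positive⁻¹ 1ℚ)))
        , (λ {q} l → subst (q - 1ℚ <_) (-‿+-cancel p 1ℚ) (-‿mono-< 1ℚ l)))
      , ((λ l → l) , lo≤hi (unitInterval (p ℚ.+ 1ℚ)))

    meet-sym : ∀ {p q} → Meet p q → Meet q p
    meet-sym (x , a , b) = x , b , a

    meet-start : ∀ {u v} w → u ~ v → Meet (start u w) (start v w)
    meet-start {u} {v} w u~v
      with to u Fin.≟ to w | u ~? w | to v Fin.≟ to w | v ~? w
    ... | yes _  | _     | yes _  | _     = meet-refl 0ℚ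
    ... | yes _  | _     | no _   | yes _ = meet-suc 0ℚ
    ... | yes p  | _     | no _   | no ¬a = contradiction
      (subst (v ~_) (to-injective p) (~-sym u~v)) ¬a
    ... | no _   | yes _ | yes _  | _     = meet-sym (meet-suc 0ℚ)
    ... | no _   | no ¬a | yes p  | _     = contradiction
      (subst (u ~_) (to-injective p) u~v) ¬a
    ... | no _   | yes _ | no _   | yes _ = meet-refl 1ℚ
    ... | no _   | yes _ | no _   | no _  = meet-suc 1ℚ
    ... | no _   | no _  | no _   | yes _ = meet-sym (meet-suc 1ℚ)
    ... | no _   | no _  | no _   | no _  = meet-refl 2ℚ

    start-self : ∀ v → start v v ≡ 0ℚ
    start-self v with to v Fin.≟ to v
    ... | yes _ = refl
    ... | no ¬p = contradiction refl ¬p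

    start-apart : ∀ {u v} → u ≢ v → ¬ (u ~ v) → start u v ≡ 2ℚ
    start-apart {u} {v} u≢v ¬a with to u Fin.≟ to v | u ~? v
    ... | yes p | _     = contradiction (to-injective p) u≢v
    ... | no _  | yes a = contradiction a ¬a
    ... | no _  | no _  = refl

    disjoint-0-2 : ¬ Meet 0ℚ 2ℚ
    disjoint-0-2 (x , (_ , x≤1) , (2≤x , _)) =
      ℚ.<-asym (x≤1 (2≤x {1½} (ℚ.+-monoʳ-< 1ℚ ½<1))) (ℚ.positive⁻¹ (1½ - 1ℚ))
      where
      ½<1 : ℚ.½ < 1ℚ
      ½<1 = subst (_< 1ℚ) (ℚ.+-identityʳ ℚ.½) (ℚ.+-monoʳ-< ℚ.½ (ℚ.positive⁻¹ ℚ.½))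

    rep-correct : IsBoxRepresentation Γ rep
    rep-correct u v u≢v = mk⇔
      (λ u~v → let m = λ i → meet-start (from i) u~v in
        (proj₁ ∘ m) , (proj₁ ∘ proj₂ ∘ m) , (proj₂ ∘ proj₂ ∘ m))
      λ (p , p∈u , p∈v) → case (u ~? v) p p∈u p∈v
      where
      case : Dec (u ~ v) → ∀ p → p ∈ ⟦ rep u ⟧ → p ∈ ⟦ rep v ⟧ → u ~ v
      case (yes a) _ _ _ = a
      case (no ¬a) p p∈u p∈v = contradiction
        (subst₂ Meet
          (trans (cong (start u) (strictlyInverseʳ u)) (start-self u))
          (trans (cong (start v) (strictlyInverseʳ u)) (start-apart (u≢v ∘ sym) (¬a ∘ ~-sym)))
          (p (to u) , p∈u (to u) , p∈v (to u)))
        disjoint-0-2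

  boxicity-exists : ¬ ¬ (∃ (IsBoxicity Γ))
  boxicity-exists = least-exists (HasBoxRepresentation Γ) (rep , rep-correct)

  cubicity-exists : ¬ ¬ (∃ (IsCubicity Γ))
  cubicity-exists = least-exists (HasCubeRepresentation Γ)
    (rep , (λ v i → (λ l → l) , (λ l → l)) , rep-correct)

{-# OPTIONS --safe #-}

-- In one coordinate of a box representation, "u lies strictly left of v" is a
-- (2+2)-free relation ⊲ that holds only between incomparable tuples.  So if a
-- coordinate separates two tuples of the segment [x,y] of the product order, it
-- cannot separate two tuples of a segment [y,z], and numbers of coordinates
-- needed for consecutive segments add up.
--
-- A segment along which two entries grow needs one coordinate.  A segment along
-- which three entries p, q, r grow needs two: raising one entry of the bottom,
-- or lowering one entry of the top, gives a 6-cycle up p - down q - up r - … .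
-- Its three antipodal pairs {up s, down s} are non-adjacent, and one coordinate
-- cannot separate two of them in the same orientation, hence not all three.
--
-- Going from 0 to m, the entries are raised in blocks of two, with a last block
-- of three (leaving out m₁ if d is even).  A block m_i ≤ m_j yields m_i and the
-- last block m_{d-2} ≤ m_{d-1} ≤ m_d yields m_{d-2} + m_{d-1}.
module Submission where

open import Defs
open import Data.Nat using (ℕ; zero; suc; _+_; _∸_; _≤_; _<_; _≥_; _⊓_; _≤?_; z≤n; s≤s; s≤s⁻¹)
open import Data.Nat.Divisibility using (_∣_; _∤_; _∣?_; divides; ∣-refl; ∣m∣n⇒∣m+n; ∣m+n∣m⇒∣n)
open import Data.Nat.ListAction using (sum)
open import Data.Nat.Properties hiding (_≟_; suc-injective)
open import Data.Empty using (⊥-elim)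
open import Data.Fin as Fin using (Fin; zero; suc) renaming (_≤_ to _≤ᶠ_)
open import Data.Fin.Properties using (_≟_; any?; sequence; injective⇒≤; suc-injective)
open import Data.List using ([]; _∷_; map; filter; allFin; tabulate)
open import Data.List.Properties using (map-tabulate)
open import Data.Product using (∃; _×_; _,_; proj₁; proj₂)
import Data.Rational.Properties as ℚ
open import Data.Sum using (_⊎_; inj₁; inj₂; [_,_]′; swap)
open import Data.Vec as Vec using (Vec; []; _∷_; _++_)
open import Data.Vec.Properties using (lookup∘tabulate)
open import Data.Vec.Relation.Unary.All as All using (All; []; _∷_)
import Data.Vec.Relation.Unary.All.Properties as All
open import Data.Vec.Relation.Unary.AllPairs using ([]; _∷_)
import Data.Vec.Relation.Unary.AllPairs.Properties as AllPairs
open import Data.Vec.Relation.Unary.Unique.Propositional using (Unique)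
open import Data.Vec.Relation.Unary.Unique.Propositional.Properties using (lookup-injective)
open import Data.Vec.Functional using (Vector; updateAt)
open import Data.Vec.Functional.Properties using (updateAt-updates; updateAt-minimal)
open import Data.Vec.Functional.Relation.Binary.Pointwise using (Pointwise)
open import Effect.Monad using (RawMonad)
open import Function.Construct.Identity using (↔-id)
open import Function using (_∘_; _↔_; case_of_; const; id; Equivalence; Inverse; Injective)
open import Level using (0ℓ)
open import Relation.Binary using (Rel; tri<; tri≈; tri>)
open import Relation.Binary.PropositionalEquality
open import Relation.Nullary using (¬_; Dec; yes; no; contradiction; ¬?)
open import Relation.Nullary.Decidable
  using (¬¬-excluded-middle; decidable-stable; _×-dec_; _⊎-dec_)
open import Relation.Nullary.Negation using (¬¬-Monad; ¬¬-map)
open import Relation.Unary as Unary using (Pred; _≐_)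

open ℝ
open Interval

-- Order of cuts and strict precedence of intervals.

-- Locatedness at `q < r`, both below `y`, puts `q` below `x` or `r` above `x`; the latter would
-- force `x ≤ᵣ y`.
≰ᵣ⇒≥ᵣ : ∀ {x y} → ¬ (x ≤ᵣ y) → y ≤ᵣ x
≰ᵣ⇒≥ᵣ {x} {y} x≰y {q} yq with Equivalence.to (L-rounded y q) yq
... | r , q<r , yr with located x q<r
...   | inj₁ xq = xq
...   | inj₂ xr = ⊥-elim (x≰y x≤y)
  where
  x≤y : x ≤ᵣ y
  x≤y {s} xs with ℚ.<-cmp s r
  ... | tri< s<r _ _  = Equivalence.from (L-rounded y s) (r , s<r , yr)
  ... | tri≈ _ refl _ = contradiction (xs , xr) (disjoint x s)
  ... | tri> _ _ r<s  = contradiction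
    (xs , Equivalence.from (U-rounded x s) (r , r<s , xr)) (disjoint x s)

infix 4 _⊲_

-- Negates `≤ᵣ`, the relation that box membership is made of. In general it cannot be decided,
-- whence the double negations below.
_⊲_ : Rel Interval 0ℓ
I ⊲ J = ¬ (lo J ≤ᵣ hi I)

⊲-irrefl : ∀ {I} → ¬ (I ⊲ I)
⊲-irrefl {I} I⊲I = I⊲I (lo≤hi I)

-- If `lo J` were at most `hi K`, then `lo J ≤ hi K ≤ lo M ≤ hi I`, against `I ⊲ J`.
⊲-2+2-free : ∀ {I J K M} → I ⊲ J → K ⊲ M → ¬ (I ⊲ M) → ¬ ¬ (K ⊲ J)
⊲-2+2-free {I} {J} {K} {M} I⊲J K⊲M ¬I⊲M ¬K⊲J =
  ¬I⊲M λ M≤I → ¬K⊲J λ J≤K →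
    I⊲J λ j → M≤I (≰ᵣ⇒≥ᵣ {lo M} {hi K} K⊲M (J≤K j))

-- Separation of tuples by single coordinates.

¬¬-sequence : ∀ {A : Set} {n} → A ↔ Fin n → {P : Pred A 0ℓ} →
  (∀ a → ¬ ¬ P a) → ¬ ¬ (∀ a → P a)
¬¬-sequence e {P} ¬¬P = ¬¬-map
  (λ Pf a → subst P (strictlyInverseʳ a) (Pf (to a)))
  (sequence (RawMonad.rawApplicative ¬¬-Monad) (¬¬P ∘ from))
  where open Inverse e

Comparable : ∀ {d} {m : Vector ℕ d} → Rel (Tuple m) 0ℓ
Comparable a b = (∀ i → a ! i ≤ b ! i) ⊎ (∀ i → a ! i ≥ b ! i)

module _ {d} {m : Vector ℕ d} {k} (f : Tuple m → Box k) where

  Separates : Fin k → Rel (Tuple m) 0ℓ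
  Separates i u v = (f u i ⊲ f v i) ⊎ (f v i ⊲ f u i)

  SeparatesIncomparable : Set
  SeparatesIncomparable = ∀ u v → ¬ Comparable u v → ∃ λ i → Separates i u v

  all-decided : (R : Rel Interval 0ℓ) → ¬ ¬ (∀ u v i → Dec (R (f u i) (f v i)))
  all-decided R =
    ¬¬-sequence V↔Fin λ _ → ¬¬-sequence V↔Fin λ _ → ¬¬-sequence (↔-id _) λ _ →
      ¬¬-excluded-middle
    where V↔Fin = proj₂ (Graph.finite (TCC m))

module _ {d} {m : Vector ℕ d} {k} (f : Tuple m → Box k)
         (f-rep : IsBoxRepresentation (TCC m) f) where

  -- Adjacent tuples share a point, whose entry `i` lies in both intervals. Equal tuples are covered
  -- too, since tuples compared later may coincide.
  comparable⇒¬⊲ : ∀ u v → Comparable u v → ∀ i → ¬ (f u i ⊲ f v i)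
  comparable⇒¬⊲ u v cmp i u⊲v = distinct λ u≡v → ⊲-irrefl {f u i}
    (subst (λ w → f u i ⊲ f w i) (sym u≡v) u⊲v)
    where
    distinct : ¬ (u ≢ v)
    distinct u≢v with Equivalence.to (f-rep u v u≢v) (u≢v , cmp)
    ... | p , p∈u , p∈v = u⊲v λ l → proj₂ (p∈u i) (proj₁ (p∈v i) l)

  -- If no coordinate separates, the larger left endpoint in each lies in both intervals, so the
  -- boxes meet and the tuples are adjacent. Deciding the finitely many endpoint comparisons costs
  -- the double negation.
  separates-incomparable : ¬ ¬ SeparatesIncomparable f
  separates-incomparable none =
    all-decided f (λ I J → lo I ≤ᵣ hi J) λ ≤hi? →
    all-decided f (λ I J → lo I ≤ᵣ lo J) λ ≤lo? →
    none (separate ≤hi? ≤lo?)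
    where
    separate : (∀ u v i → Dec (lo (f u i) ≤ᵣ hi (f v i))) →
               (∀ u v i → Dec (lo (f u i) ≤ᵣ lo (f v i))) → SeparatesIncomparable f
    separate ≤hi? ≤lo? u v ¬cmp with any? (λ i → ¬? (≤hi? v u i) ⊎-dec ¬? (≤hi? u v i))
    ... | yes sep = sep
    ... | no ¬sep = contradiction
      (proj₂ (Equivalence.from (f-rep u v u≢v) (proj₁ ∘ meet , proj₁ ∘ proj₂ ∘ meet , proj₂ ∘ proj₂ ∘ meet)))
      ¬cmp
      where
      u≢v : u ≢ v
      u≢v refl = ¬cmp (inj₁ λ _ → ≤-refl)

      meet : ∀ i → ∃ λ x → (lo (f u i) ≤ᵣ x × x ≤ᵣ hi (f u i))
                         × (lo (f v i) ≤ᵣ x × x ≤ᵣ hi (f v i))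
      meet i with ≤lo? u v i
      ... | yes lu≤lv = lo (f v i) , (lu≤lv , decidable-stable (≤hi? v u i) λ n → ¬sep (i , inj₁ n))
                                   , (id , lo≤hi (f v i))
      ... | no  lu≰lv = lo (f u i) , (id , lo≤hi (f u i))
                                   , (≰ᵣ⇒≥ᵣ {lo (f u i)} {lo (f v i)} lu≰lv
                                     , decidable-stable (≤hi? u v i) λ n → ¬sep (i , inj₂ n))

-- Reindexing the sums over odd and even positions.

sum-filter-tabulate : ∀ {d n} {P : Pred (Fin d) 0ℓ} {Q : Pred (Fin n) 0ℓ}
  (P? : Unary.Decidable P) (Q? : Unary.Decidable Q) (g : Fin n → Fin d) (v : Vector ℕ d) →
  P ∘ g ≐ Q → sum (map v (filter P? (tabulate g))) ≡ sumOver Q? (v ∘ g)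
sum-filter-tabulate {n = n} P? Q? g v P∘g≐Q =
  trans (cong (sum ∘ map v ∘ filter P?) (sym (map-tabulate id g))) (go (allFin n))
  where
  go : ∀ is → sum (map v (filter P? (map g is))) ≡ sum (map (v ∘ g) (filter Q? is))
  go []       = refl
  go (i ∷ is) with P? (g i) | Q? i
  ... | yes _ | yes _ = cong (v (g i) +_) (go is)
  ... | no  _ | no  _ = go is
  ... | yes p | no ¬q = contradiction (proj₁ P∘g≐Q p) ¬q
  ... | no ¬p | yes q = contradiction (proj₂ P∘g≐Q q) ¬p

odd? : ∀ {d} (i : Fin d) → Dec (2 ∤ index i × index i ≤ d ∸ 2)
odd? {d} i = ¬? (2 ∣? index i) ×-dec (index i ≤? d ∸ 2)

even? : ∀ {d} (i : Fin d) → Dec (2 ∣ index i × index i ≤ d ∸ 2)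
even? {d} i = (2 ∣? index i) ×-dec (index i ≤? d ∸ 2)

-- Evaluation keeps position 1 and drops position 2; a shift by two preserves parity and lowers the
-- bound `d ∸ 2` by two.
oddSum-peel : ∀ {n} (v : Vector ℕ (5 + n)) → oddSum v ≡ v zero + oddSum (v ∘ Fin.suc ∘ Fin.suc)
oddSum-peel v = cong (v zero +_) (sum-filter-tabulate odd? odd? (Fin.suc ∘ Fin.suc) v
  ( (λ (odd , le) → odd ∘ ∣m∣n⇒∣m+n ∣-refl , s≤s⁻¹ (s≤s⁻¹ le))
  , (λ (odd , le) → (λ 2∣ → odd (∣m+n∣m⇒∣n 2∣ ∣-refl)) , s≤s (s≤s le))))

2∣suc⇔2∤ : ∀ n → (2 ∣ suc n → 2 ∤ n) × (2 ∤ n → 2 ∣ suc n)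
2∣suc⇔2∤ zero          = (λ 2∣1 → contradiction 2∣1 λ { (divides (suc _) ()) }) , contradiction (divides 0 refl)
2∣suc⇔2∤ (suc zero)    = (λ _ → λ { (divides zero ()) ; (divides (suc _) ()) }) , λ _ → ∣-refl
2∣suc⇔2∤ (suc (suc n)) =
  (λ 2∣ 2∣′ → proj₁ (2∣suc⇔2∤ n) (∣m+n∣m⇒∣n 2∣ ∣-refl) (∣m+n∣m⇒∣n 2∣′ ∣-refl)) ,
  (λ 2∤ → ∣m∣n⇒∣m+n ∣-refl (proj₂ (2∣suc⇔2∤ n) (2∤ ∘ ∣m∣n⇒∣m+n ∣-refl)))

-- Position 1 is odd and drops out; a shift by one swaps the parities and lowers the bound by one.
evenSum≡oddSum : ∀ {n} (v : Vector ℕ (3 + n)) → evenSum v ≡ oddSum (v ∘ Fin.suc)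
evenSum≡oddSum v = sum-filter-tabulate even? odd? suc v
  ( (λ {i} (ev , le) → proj₁ (2∣suc⇔2∤ (index i)) ev , s≤s⁻¹ le)
  , (λ {i} (odd , le) → proj₂ (2∣suc⇔2∤ (index i)) odd , s≤s le))

-- Tuples with prescribed entries, and segments of the product order.

infix 4 _≼_

_≼_ : ∀ {d} → Rel (Vector ℕ d) 0ℓ
_≼_ = Pointwise _≤_

_[_≔_] : ∀ {d} → Vector ℕ d → Fin d → ℕ → Vector ℕ d
x [ p ≔ c ] = updateAt x p (const c)

≔-pointwise : ∀ {d} (P : Fin d → ℕ → Set) {x : Vector ℕ d} {p c} →
  (∀ i → P i (x i)) → P p c → ∀ i → P i ((x [ p ≔ c ]) i)
≔-pointwise P {x} {p} Px Pc i with i ≟ p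
... | yes refl = subst (P i) (sym (updateAt-updates i x)) Pc
... | no i≢p   = subst (P i) (sym (updateAt-minimal i p x i≢p)) (Px i)

module _ {d} {m : Vector ℕ d} where

  vertex : (v : Vector ℕ d) → v ≼ m → Tuple m
  vertex v v≼m = tuple (Vec.tabulate v)
    λ i → subst (_≤ m i) (sym (lookup∘tabulate v i)) (v≼m i)

  vertex-! : ∀ v v≼m i → vertex v v≼m ! i ≡ v i
  vertex-! v _ = lookup∘tabulate v

  infix 4 _∈[_,_]

  _∈[_,_] : Tuple m → Vector ℕ d → Vector ℕ d → Set
  a ∈[ x , y ] = ∀ i → x i ≤ a ! i × a ! i ≤ y i

  vertex-∈ : ∀ {x y v} (v≼m : v ≼ m) → x ≼ v → v ≼ y → vertex v v≼m ∈[ x , y ]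
  vertex-∈ {x} {y} {v} v≼m x≼v v≼y i =
    subst (λ c → x i ≤ c × c ≤ y i) (sym (vertex-! v v≼m i)) (x≼v i , v≼y i)

  vertex-comparable : ∀ {v w} (v≼m : v ≼ m) (w≼m : w ≼ m) → v ≼ w → Comparable (vertex v v≼m) (vertex w w≼m)
  vertex-comparable {v} {w} v≼m w≼m v≼w =
    inj₁ λ i → subst₂ _≤_ (sym (vertex-! v v≼m i)) (sym (vertex-! w w≼m i)) (v≼w i)

  vertex-incomparable : ∀ {v w} (v≼m : v ≼ m) (w≼m : w ≼ m) p q → w p < v p → v q < w q →
    ¬ Comparable (vertex v v≼m) (vertex w w≼m)
  vertex-incomparable {v} {w} v≼m w≼m p q wp<vp vq<wq =
    [ (λ v≤w → <⇒≱ wp<vp (subst₂ _≤_ (vertex-! v v≼m p) (vertex-! w w≼m p) (v≤w p)))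
    , (λ v≥w → <⇒≱ vq<wq (subst₂ _≤_ (vertex-! w w≼m q) (vertex-! v v≼m q) (v≥w q))) ]′

≼-trans : ∀ {d} {x y z : Vector ℕ d} → x ≼ y → y ≼ z → x ≼ z
≼-trans x≼y y≼z i = ≤-trans (x≼y i) (y≼z i)

-- Counting the separating coordinates of a segment.

module _ {d} {m : Vector ℕ d} {k} (f : Tuple m → Box k)
         (f-rep : IsBoxRepresentation (TCC m) f)
         (separate : SeparatesIncomparable f) where

  SeparatesIn : Vector ℕ d → Vector ℕ d → Pred (Fin k) 0ℓ
  SeparatesIn x y i = ∃ λ a → ∃ λ b → a ∈[ x , y ] × b ∈[ x , y ] × f a i ⊲ f b i

  SeparatesIn-widen : ∀ {x x′ y y′ i} → x′ ≼ x → y ≼ y′ → SeparatesIn x y i → SeparatesIn x′ y′ i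
  SeparatesIn-widen x′≼x y≼y′ (a , b , a∈ , b∈ , a⊲b) =
    a , b , widen a a∈ , widen b b∈ , a⊲b
    where
    widen : ∀ a → a ∈[ _ , _ ] → a ∈[ _ , _ ]
    widen a a∈ i = ≤-trans (x′≼x i) (proj₁ (a∈ i)) , ≤-trans (proj₂ (a∈ i)) (y≼y′ i)

  -- `a`, `b` lie below `y` and `a′`, `b′` above it, so all cross pairs are comparable and the two
  -- separations would form a 2+2.
  SeparatesIn-disjoint : ∀ {x y z i} → SeparatesIn x y i → ¬ SeparatesIn y z i
  SeparatesIn-disjoint {i = i} (a , b , a∈ , b∈ , a⊲b) (a′ , b′ , a′∈ , b′∈ , a′⊲b′) =
    ⊲-2+2-free {f a i} {f b i} {f a′ i} {f b′ i} a⊲b a′⊲b′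
      (comparable⇒¬⊲ f f-rep a b′ (inj₁ λ j → ≤-trans (proj₂ (a∈ j)) (proj₁ (b′∈ j))) i)
      (comparable⇒¬⊲ f f-rep a′ b (inj₂ λ j → ≤-trans (proj₂ (b∈ j)) (proj₁ (a′∈ j))) i)

  -- A list makes addition a concatenation; its distinctness bounds `w` by `k`.
  Needs : Vector ℕ d → Vector ℕ d → ℕ → Set
  Needs x y w = ∃ λ (is : Vec (Fin k) w) → All (SeparatesIn x y) is × Unique is

  Needs⇒≤ : ∀ {x y w} → Needs x y w → w ≤ k
  Needs⇒≤ (_ , _ , is!) = injective⇒≤ (lookup-injective is! _ _)

  Needs-zero : ∀ {x y} → Needs x y 0
  Needs-zero = [] , [] , []

  Needs-+ : ∀ {x y z v w} → x ≼ y → y ≼ z → Needs x y v → Needs y z w → Needs x z (v + w)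
  Needs-+ x≼y y≼z (is , is-sep , is!) (js , js-sep , js!) =
      is ++ js
    , All.++⁺ (All.map (SeparatesIn-widen (λ _ → ≤-refl) y≼z) is-sep)
              (All.map (SeparatesIn-widen x≼y (λ _ → ≤-refl)) js-sep)
    , AllPairs.++⁺ is! js!
        (All.map (λ i-sep → All.map (λ j-sep → λ { refl → SeparatesIn-disjoint i-sep j-sep }) js-sep)
          is-sep)

  -- Raised bottoms and lowered tops of a segment.

  module _ {x y : Vector ℕ d} (x≼y : x ≼ y) (y≼m : y ≼ m) where

    up≼y : ∀ p → x [ p ≔ y p ] ≼ y
    up≼y p = ≔-pointwise (λ i c → c ≤ y i) x≼y ≤-refl

    x≼up : ∀ p → x ≼ x [ p ≔ y p ]
    x≼up p = ≔-pointwise (λ i c → x i ≤ c) (λ _ → ≤-refl) (x≼y p)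

    down≼y : ∀ p → y [ p ≔ x p ] ≼ y
    down≼y p = ≔-pointwise (λ i c → c ≤ y i) (λ _ → ≤-refl) (x≼y p)

    x≼down : ∀ p → x ≼ y [ p ≔ x p ]
    x≼down p = ≔-pointwise (λ i c → x i ≤ c) x≼y ≤-refl

    up≼m : ∀ p → x [ p ≔ y p ] ≼ m
    up≼m p = ≼-trans (up≼y p) y≼m

    down≼m : ∀ p → y [ p ≔ x p ] ≼ m
    down≼m p = ≼-trans (down≼y p) y≼m

    up down : Fin d → Tuple m
    up p   = vertex (x [ p ≔ y p ]) (up≼m p)
    down p = vertex (y [ p ≔ x p ]) (down≼m p)

    up-down-comparable : ∀ p q → p ≢ q → Comparable (up p) (down q)
    up-down-comparable p q p≢q = vertex-comparable (up≼m p) (down≼m q)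
      (≔-pointwise (λ i c → c ≤ (y [ q ≔ x q ]) i)
        (x≼down q)
        (≤-reflexive (sym (updateAt-minimal p q y p≢q))))

    -- `up p` is larger at `p`; at the second growing entry `q` it still has the bottom value, while
    -- `down p` has the top one.
    up-down-incomparable : ∀ p q → p ≢ q → x p < y p → x q < y q →
      ¬ Comparable (up p) (down p)
    up-down-incomparable p q p≢q xp<yp xq<yq = vertex-incomparable (up≼m p) (down≼m p) p q
      (subst₂ _<_ (sym (updateAt-updates p y)) (sym (updateAt-updates p x)) xp<yp)
      (subst₂ _<_ (sym (updateAt-minimal q p x (p≢q ∘ sym)))
                  (sym (updateAt-minimal q p y (p≢q ∘ sym))) xq<yq)

    Separates⇒SeparatesIn : ∀ p {i} → Separates f i (up p) (down p) → SeparatesIn x y i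
    Separates⇒SeparatesIn p =
      [ (λ u⊲d → up p , down p , up∈ , down∈ , u⊲d)
      , (λ d⊲u → down p , up p , down∈ , up∈ , d⊲u) ]′
      where
      up∈   = vertex-∈ (up≼m p) (x≼up p) (up≼y p)
      down∈ = vertex-∈ (down≼m p) (x≼down p) (down≼y p)

    ¬both-up⊲down : ∀ p q i → p ≢ q →
      f (up p) i ⊲ f (down p) i → ¬ (f (up q) i ⊲ f (down q) i)
    ¬both-up⊲down p q i p≢q s t =
      ⊲-2+2-free {f (up p) i} {f (down p) i} {f (up q) i} {f (down q) i} s t
        (comparable⇒¬⊲ f f-rep (up p) (down q) (up-down-comparable p q p≢q) i)
        (comparable⇒¬⊲ f f-rep (up q) (down p) (up-down-comparable q p (p≢q ∘ sym)) i)

    ¬both-down⊲up : ∀ p q i → p ≢ q →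
      f (down p) i ⊲ f (up p) i → ¬ (f (down q) i ⊲ f (up q) i)
    ¬both-down⊲up p q i p≢q s t =
      ⊲-2+2-free {f (down p) i} {f (up p) i} {f (down q) i} {f (up q) i} s t
        (comparable⇒¬⊲ f f-rep (down p) (up q) (swap (up-down-comparable q p (p≢q ∘ sym))) i)
        (comparable⇒¬⊲ f f-rep (down q) (up p) (swap (up-down-comparable p q p≢q)) i)

    ¬separates-three : ∀ p q r {i} → p ≢ q → p ≢ r → q ≢ r →
      Separates f i (up p) (down p) → Separates f i (up q) (down q) →
      ¬ Separates f i (up r) (down r)
    ¬separates-three p q r {i} p≢q p≢r q≢r = λ where
        (inj₁ s) (inj₁ t) _        → ¬both-up⊲down p q i p≢q s t
        (inj₁ s) (inj₂ t) (inj₁ u) → ¬both-up⊲down p r i p≢r s u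
        (inj₁ s) (inj₂ t) (inj₂ u) → ¬both-down⊲up q r i q≢r t u
        (inj₂ s) (inj₁ t) (inj₁ u) → ¬both-up⊲down q r i q≢r t u
        (inj₂ s) (inj₁ t) (inj₂ u) → ¬both-down⊲up p r i p≢r s u
        (inj₂ s) (inj₂ t) _        → ¬both-down⊲up p q i p≢q s t

    Needs-pair : ∀ {p q} → p ≢ q → x p < y p → x q < y q → Needs x y 1
    Needs-pair {p} {q} p≢q p↑ q↑ =
      let i , s = separate (up p) (down p) (up-down-incomparable p q p≢q p↑ q↑) in
      i ∷ [] , Separates⇒SeparatesIn p s ∷ [] , [] ∷ []

    Needs-triple : ∀ {p q r} → p ≢ q → p ≢ r → q ≢ r →
      x p < y p → x q < y q → x r < y r → Needs x y 2
    Needs-triple {p} {q} {r} p≢q p≢r q≢r p↑ q↑ r↑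
      -- Each pair takes the next of `p`, `q`, `r` in cyclic order as its second growing entry.
      with separate (up p) (down p) (up-down-incomparable p q p≢q p↑ q↑)
         | separate (up q) (down q) (up-down-incomparable q r q≢r q↑ r↑)
         | separate (up r) (down r) (up-down-incomparable r p (p≢r ∘ sym) r↑ p↑)
    ... | i , s | j , t | l , u with i ≟ j
    ...   | no i≢j   = i ∷ j ∷ [] , Separates⇒SeparatesIn p s ∷ Separates⇒SeparatesIn q t ∷ []
                     , (i≢j ∷ []) ∷ [] ∷ []
    -- One coordinate serves both `p` and `q`, so the one found for `r` must differ from it.
    ...   | yes refl = i ∷ l ∷ [] , Separates⇒SeparatesIn p s ∷ Separates⇒SeparatesIn r u ∷ []
                     , ((λ { refl → ¬separates-three p q r p≢q p≢r q≢r s t u }) ∷ []) ∷ [] ∷ []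

  -- Paths of unit steps through a segment.

  -- All entries move at once, so the same path serves any choice of `p`, `q`, `r`; the minimum
  -- keeps it below `y`.
  step : Vector ℕ d → Vector ℕ d → Vector ℕ d
  step x y i = suc (x i) ⊓ y i

  module _ {x y : Vector ℕ d} (x≼y : x ≼ y) where

    x≼step : x ≼ step x y
    x≼step i = ⊓-glb (n≤1+n (x i)) (x≼y i)

    step≼y : step x y ≼ y
    step≼y i = m⊓n≤n (suc (x i)) (y i)

    step-rises : ∀ {t p} → suc t + x p ≤ y p → x p < step x y p
    step-rises {t} {p} le = ⊓-glb ≤-refl (≤-trans (s≤s (m≤n+m (x p) t)) le)

    step-room : ∀ {t p} → suc t + x p ≤ y p → t + step x y p ≤ y p
    step-room {t} {p} le = begin
      t + step x y p  ≤⟨ +-monoʳ-≤ t (m⊓n≤m (suc (x p)) (y p)) ⟩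
      t + suc (x p)   ≡⟨ +-suc t (x p) ⟩
      suc t + x p     ≤⟨ le ⟩
      y p             ∎
      where open ≤-Reasoning

  -- `t` is room left in both entries: a step raises both, yields one coordinate and uses up one
  -- unit of room.
  Needs-pairs : ∀ t {x y p q} → x ≼ y → y ≼ m → p ≢ q →
    t + x p ≤ y p → t + x q ≤ y q → Needs x y t
  Needs-pairs zero    x≼y y≼m p≢q p↑ q↑ = Needs-zero
  Needs-pairs (suc t) x≼y y≼m p≢q p↑ q↑ = Needs-+ (x≼step x≼y) (step≼y x≼y)
    (Needs-pair (x≼step x≼y) (≼-trans (step≼y x≼y) y≼m) p≢q
      (step-rises x≼y p↑) (step-rises x≼y q↑))
    (Needs-pairs t (step≼y x≼y) y≼m p≢q (step-room x≼y p↑) (step-room x≼y q↑))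

  -- The first `s` steps raise three entries and yield two coordinates each; the other `t - s` raise
  -- `q` and `r` and yield one each. The total is `2s + (t - s)`.
  Needs-triples : ∀ {s t x y p q r} → s ≤ t → x ≼ y → y ≼ m → p ≢ q → p ≢ r → q ≢ r →
    s + x p ≤ y p → t + x q ≤ y q → t + x r ≤ y r → Needs x y (s + t)
  Needs-triples {t = t} z≤n x≼y y≼m p≢q p≢r q≢r p↑ q↑ r↑ = Needs-pairs t x≼y y≼m q≢r q↑ r↑
  Needs-triples {suc s} {suc t} (s≤s s≤t) x≼y y≼m p≢q p≢r q≢r p↑ q↑ r↑ =
    subst (Needs _ _) (cong suc (sym (+-suc s t)))
      (Needs-+ (x≼step x≼y) (step≼y x≼y)
        (Needs-triple (x≼step x≼y) (≼-trans (step≼y x≼y) y≼m) p≢q p≢r q≢r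
          (step-rises x≼y p↑) (step-rises x≼y q↑) (step-rises x≼y r↑))
        (Needs-triples s≤t (step≼y x≼y) y≼m p≢q p≢r q≢r
          (step-room x≼y p↑) (step-room x≼y q↑) (step-room x≼y r↑)))

  -- Blocks of two entries and a last block of three.

  -- `ι` selects the entries still to be raised, so the induction shortens the index set while `m`
  -- stays fixed; elsewhere `x` may already have grown.
  Needs-odd : ∀ n (ι : Fin (3 + n) → Fin d) → Injective _≡_ _≡_ ι → 2 ∤ 3 + n →
    (∀ i j → i ≤ᶠ j → m (ι i) ≤ m (ι j)) → ∀ {x} → x ≼ m → (∀ i → x (ι i) ≡ 0) →
    Needs x m (oddSum (m ∘ ι) + penultimate (m ∘ ι))
  Needs-odd zero ι ι-inj _ m-mono {x} x≼m x≡0 =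
    subst (λ s → Needs x m (s + m (ι (suc zero)))) (sym (+-identityʳ (m (ι zero))))
      (Needs-triples {p = ι zero} {ι (suc zero)} {ι (suc (suc zero))}
        (m-mono zero (suc zero) z≤n) x≼m (λ _ → ≤-refl)
        (λ e → case ι-inj e of λ ()) (λ e → case ι-inj e of λ ()) (λ e → case ι-inj e of λ ())
        (room zero ≤-refl) (room (suc zero) ≤-refl)
        (room (suc (suc zero)) (m-mono (suc zero) (suc (suc zero)) (s≤s z≤n))))
    where
    room : ∀ i {c} → c ≤ m (ι i) → c + x (ι i) ≤ m (ι i)
    room i {c} c≤m rewrite x≡0 i | +-identityʳ c = c≤m
  -- The induction descends by two, so parity excludes length four.
  Needs-odd (suc zero) _ _ 2∤4 = contradiction (divides 2 refl) 2∤4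
  Needs-odd (suc (suc n)) ι ι-inj 2∤5+n m-mono {x} x≼m x≡0 =
    subst (Needs x m) total
      (Needs-+ x≼y y≼m
        -- Monotonicity gives `q` room for all `m p` steps.
        (Needs-pairs (m p) x≼y y≼m p≢q (rises p x≡0p yp ≤-refl) (rises q x≡0q yq (m-mono zero (suc zero) z≤n)))
        (Needs-odd n ι′ (suc-injective ∘ suc-injective ∘ ι-inj) (2∤5+n ∘ ∣m∣n⇒∣m+n ∣-refl)
          (λ i j i≤j → m-mono _ _ (s≤s (s≤s i≤j))) y≼m y≡0))
    where
    ι′ : Fin (3 + n) → Fin d
    ι′ = ι ∘ Fin.suc ∘ Fin.suc

    p q : Fin d
    p = ι zero
    q = ι (suc zero)

    p≢q : p ≢ q
    p≢q e = case ι-inj e of λ ()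

    x≡0p = x≡0 zero
    x≡0q = x≡0 (suc zero)

    -- `y` fills the first block to the top and copies `x` elsewhere, so it still vanishes along
    -- `ι′`.
    z y : Vector ℕ d
    z = x [ p ≔ m p ]
    y = z [ q ≔ m q ]

    x≼y : x ≼ y
    x≼y = ≔-pointwise (λ i c → x i ≤ c)
      (≔-pointwise (λ i c → x i ≤ c) (λ _ → ≤-refl) (x≼m p)) (x≼m q)

    y≼m : y ≼ m
    y≼m = ≔-pointwise (λ i c → c ≤ m i) (≔-pointwise (λ i c → c ≤ m i) x≼m ≤-refl) ≤-refl

    yp : y p ≡ m p
    yp = trans (updateAt-minimal p q z p≢q) (updateAt-updates p x)

    yq : y q ≡ m q
    yq = updateAt-updates q z

    y≡0 : ∀ i → y (ι′ i) ≡ 0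
    y≡0 i = trans
      (updateAt-minimal (ι′ i) q z λ e → case ι-inj e of λ ())
      (trans (updateAt-minimal (ι′ i) p x λ e → case ι-inj e of λ ()) (x≡0 (suc (suc i))))

    rises : ∀ r → x r ≡ 0 → y r ≡ m r → ∀ {c} → c ≤ m r → c + x r ≤ y r
    rises r xr yr {c} c≤m rewrite xr | yr | +-identityʳ c = c≤m

    total : m p + (oddSum (m ∘ ι′) + penultimate (m ∘ ι′)) ≡ oddSum (m ∘ ι) + penultimate (m ∘ ι)
    total = trans (sym (+-assoc (m p) (oddSum (m ∘ ι′)) (penultimate (m ∘ ι′))))
      (cong (_+ penultimate (m ∘ ι′)) (sym (oddSum-peel (m ∘ ι))))

-- From separating coordinates to boxicity.

module _ {d} {m : Vector ℕ d} {box} (is-box : IsBoxicity (TCC m) box) where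

  cubicity≥boxicity : ∀ cub → IsCubicity (TCC m) cub → cub ≥ box
  cubicity≥boxicity cub ((f , _ , f-rep) , _) = proj₂ is-box cub (f , f-rep)

  -- Separating coordinates are available only under a double negation, which the decidable goal
  -- `w ≤ box` absorbs.
  Needs⇒boxicity≥ : ∀ {x y w} →
    (∀ (f : Tuple m → Box box) f-rep sep → Needs f f-rep sep x y w) → box ≥ w
  Needs⇒boxicity≥ {w = w} needs with proj₁ is-box
  ... | f , f-rep = decidable-stable (w ≤? box)
    (¬¬-map (λ sep → Needs⇒≤ f f-rep sep (needs f f-rep sep)) (separates-incomparable f f-rep))

theorem2 : ∀ (n : ℕ) → let d = 2 + n in
    (m : Vector ℕ d) →
    (∀ i → 1 ≤ m i) →
    (∀ i j → i ≤ᶠ j → m i ≤ m j) →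
    ∀ box → IsBoxicity (TCC m) box →
    (d ≡ 2 →
    (∀ cub → IsCubicity (TCC m) cub → cub ≥ box) ×
    box ≥ m zero) ×
    (d ≥ 3 →
    (∀ cub → IsCubicity (TCC m) cub → cub ≥ box) ×
    (2 ∤ d → box ≥ oddSum m + penultimate m) ×
    (2 ∣ d → box ≥ evenSum m + penultimate m))
theorem2 zero m _ m-mono box is-box =
    (λ _ → cubicity≥boxicity is-box , Needs⇒boxicity≥ is-box λ f f-rep sep →
      -- The whole segment from 0 to `m` is a single block of two.
      Needs-pairs f f-rep sep (m zero) {const 0} {p = zero} {suc zero} (λ _ → z≤n) (λ _ → ≤-refl) (λ ())
        (≤-reflexive (+-identityʳ _))
        (≤-trans (≤-reflexive (+-identityʳ _)) (m-mono zero (suc zero) z≤n)))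
  , λ { (s≤s (s≤s ())) }
theorem2 (suc n) m _ m-mono box is-box =
    (λ ())
  , λ _ → cubicity≥boxicity is-box
        , (λ 2∤d → Needs⇒boxicity≥ is-box λ f f-rep sep →
            Needs-odd f f-rep sep n id id 2∤d m-mono {const 0} (λ _ → z≤n) (λ _ → refl))
        , even n m m-mono is-box
  where
  even : ∀ n (m : Vector ℕ (3 + n)) → (∀ i j → i ≤ᶠ j → m i ≤ m j) →
    IsBoxicity (TCC m) box → 2 ∣ 3 + n → box ≥ evenSum m + penultimate m
  even zero    m _      _      2∣3 = contradiction ∣-refl (proj₁ (2∣suc⇔2∤ 2) 2∣3)
  even (suc n) m m-mono is-box 2∣d =
    subst (λ s → box ≥ s + penultimate m) (sym (evenSum≡oddSum m))
      (Needs⇒boxicity≥ is-box λ f f-rep sep →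
        -- With `suc` as `ι` the first entry is left out, and the remaining number of entries is
        -- odd.
        Needs-odd f f-rep sep n suc suc-injective (proj₁ (2∣suc⇔2∤ _) 2∣d)
          (λ i j i≤j → m-mono (suc i) (suc j) (s≤s i≤j)) {const 0} (λ _ → z≤n) (λ _ → refl))
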